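{- Let $a,b$ be positive integers, and let $F_n(q)$ and $\widehat{F}_n(q)$ be the sequences defined in the context. For all integers $n\geq 0$ and $k\geq 1$, $$F_n(q)\widehat{F}_{n+k}(q)-F_{n+k}(q)\widehat{F}_{n}(q) =(-1)^{n-1}q^{\binom n2}\sum_{j=0}^{k-1}{k-1-j\brack j}\, a^{\left\lfloor\frac{k-1}{2}\right\rfloor + \xi(k+1)\xi(n+1)-j}\,b^{\left\lfloor\frac{k-1}{2}\right\rfloor + \xi(k+1)\xi(n)-j}\,q^{j^2+nj}.$$
   Context: Fix positive integers $a,b$; $q$ is an indeterminate. The $q$-biperiodic Fibonacci sequence is defined by $F_0(q)=0$, $F_1(q)=1$ and, for $n\geq 2$, $F_n(q)=aF_{n-1}(q)+q^{n-2}F_{n-2}(q)$ if $n$ is even, $F_n(q)=bF_{n-1}(q)+q^{n-2}F_{n-2}(q)$ if $n$ is odd. The sequence $\widehat{F}_n(q)$ satisfies the same recurrence for $n\geq 2$, namely $\widehat{F}_n(q)=a\widehat{F}_{n-1}(q)+q^{n-2}\widehat{F}_{n-2}(q)$ if $n$ is even and $\widehat{F}_n(q)=b\widehat{F}_{n-1}(q)+q^{n-2}\widehat{F}_{n-2}(q)$ if $n$ is odd, with initial values $\widehat{F}_0(q)=1$, $\widehat{F}_1(q)=0$. For an integer $n$, $\xi(n)=n-2\lfloor n/2\rfloor$ (so $\xi(n)=0$ if $n$ is even and $1$ if $n$ is odd). The $q$-binomial coefficient is ${n\brack k}=\frac{[n]_q!}{[k]_q!\,[n-k]_q!}$ for $0\leq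 k\leq n$ and ${n\brack k}=0$ for $k<0$ or $k>n\geq 0$, where $[n]_q=1+q+\cdots+q^{n-1}$ and $[n]_q!=[1]_q[2]_q\cdots[n]_q$, $[0]_q!=1$. Terms with vanishing $q$-binomial coefficient are zero (even if the exponents of $a$ or $b$ are negative). -}

module Defs where

open import Algebra.Bundles using (CommutativeMonoid; CommutativeRing; Semiring)
open import Algebra.Structures using (IsAbelianGroup)
open import Algebra.Definitions.RawMagma using (_,_; module _∣ʳ_)
import Algebra.Definitions.RawSemiring as RawSemiringDefinitions
import Algebra.Properties.CommutativeSemigroup as CommutativeSemigroupProperties
import Algebra.Properties.CommutativeMonoid.Sum as SumProperties
import Algebra.Properties.Semiring.Sum as SemiringSumProperties
open import Data.Fin using (toℕ)
open import Data.Integer as ℤ using (ℤ; 0ℤ; 1ℤ)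
import Data.Integer.Properties as ℤ
open import Data.List using (List; []; _∷_; map)
open import Data.Nat using (ℕ; zero; suc; _+_; _*_; _∸_; _≤_; _≤?_; ⌊_/2⌋; parity)
import Data.Nat.Properties as ℕ
open import Data.Parity using (0ℙ; 1ℙ)
open import Data.Product using (_,_)
open import Relation.Binary.PropositionalEquality as ≡ using (_≡_; cong; cong₂)
open import Relation.Binary.Structures using (IsEquivalence)
open import Relation.Nullary using (yes; no)
import Relation.Binary.Reasoning.Setoid as SetoidReasoning

-- c₀ ∷ c₁ ∷ … ∷ cₘ ∷ [] is the polynomial c₀ + c₁q + … + cₘqᵐ.  Trailing
-- zeros are allowed, so polynomials are compared by _≈_ and not by _≡_.
Poly : Set
Poly = List ℤ

coeff : Poly → ℕ → ℤ
coeff []      _       = 0ℤ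
coeff (c ∷ p) zero    = c
coeff (c ∷ p) (suc i) = coeff p i

infix 4 _≈_

record _≈_ (p r : Poly) : Set where
  constructor coeffwise
  field coeff-≡ : ∀ i → coeff p i ≡ coeff r i

open _≈_ public

constant : ℤ → Poly
constant c = c ∷ []

q : Poly
q = 0ℤ ∷ 1ℤ ∷ []

0ᴾ 1ᴾ : Poly
0ᴾ = []
1ᴾ = constant 1ℤ

infixl 6 _+ᴾ_
infixl 7 _*ᴾ_ _·_
infix  8 -ᴾ_

_+ᴾ_ : Poly → Poly → Poly
[]      +ᴾ r       = r
(c ∷ p) +ᴾ []      = c ∷ p
(c ∷ p) +ᴾ (d ∷ r) = (c ℤ.+ d) ∷ (p +ᴾ r)

-ᴾ_ : Poly → Poly
-ᴾ_ = map (ℤ.-_)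

_·_ : ℤ → Poly → Poly
c · p = map (c ℤ.*_) p

_*ᴾ_ : Poly → Poly → Poly
[]      *ᴾ r = []
(c ∷ p) *ᴾ r = c · r +ᴾ (0ℤ ∷ p *ᴾ r)

coeff-+ : ∀ p r i → coeff (p +ᴾ r) i ≡ coeff p i ℤ.+ coeff r i
coeff-+ []      r       i       = ≡.sym (ℤ.+-identityˡ _)
coeff-+ (c ∷ p) []      i       = ≡.sym (ℤ.+-identityʳ _)
coeff-+ (c ∷ p) (d ∷ r) zero    = ≡.refl
coeff-+ (c ∷ p) (d ∷ r) (suc i) = coeff-+ p r i

coeff-neg : ∀ p i → coeff (-ᴾ p) i ≡ ℤ.- coeff p i
coeff-neg []      i       = ≡.refl
coeff-neg (c ∷ p) zero    = ≡.refl
coeff-neg (c ∷ p) (suc i) = coeff-neg p i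

coeff-· : ∀ c p i → coeff (c · p) i ≡ c ℤ.* coeff p i
coeff-· c []      i       = ≡.sym (ℤ.*-zeroʳ c)
coeff-· c (d ∷ p) zero    = ≡.refl
coeff-· c (d ∷ p) (suc i) = coeff-· c p i

≈-isEquivalence : IsEquivalence _≈_
≈-isEquivalence = record
  { refl  = coeffwise λ _ → ≡.refl
  ; sym   = λ e → coeffwise λ i → ≡.sym (coeff-≡ e i)
  ; trans = λ e f → coeffwise λ i → ≡.trans (coeff-≡ e i) (coeff-≡ f i)
  }

open IsEquivalence ≈-isEquivalence using () renaming
  (refl to ≈-refl; sym to ≈-sym; trans to ≈-trans)

+ᴾ-cong : ∀ {p p′ r r′} → p ≈ p′ → r ≈ r′ → p +ᴾ r ≈ p′ +ᴾ r′
+ᴾ-cong {p} {p′} {r} {r′} e f = coeffwise λ i → begin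
  coeff (p +ᴾ r) i            ≡⟨ coeff-+ p r i ⟩
  coeff p i ℤ.+ coeff r i     ≡⟨ cong₂ ℤ._+_ (coeff-≡ e i) (coeff-≡ f i) ⟩
  coeff p′ i ℤ.+ coeff r′ i   ≡⟨ coeff-+ p′ r′ i ⟨
  coeff (p′ +ᴾ r′) i          ∎
  where open ≡.≡-Reasoning

+ᴾ-assoc : ∀ p r s → (p +ᴾ r) +ᴾ s ≈ p +ᴾ (r +ᴾ s)
+ᴾ-assoc p r s = coeffwise λ i → begin
  coeff ((p +ᴾ r) +ᴾ s) i                       ≡⟨ coeff-+ (p +ᴾ r) s i ⟩
  coeff (p +ᴾ r) i ℤ.+ coeff s i                ≡⟨ cong (ℤ._+ coeff s i) (coeff-+ p r i) ⟩
  (coeff p i ℤ.+ coeff r i) ℤ.+ coeff s i       ≡⟨ ℤ.+-assoc (coeff p i) (coeff r i) (coeff s i) ⟩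
  coeff p i ℤ.+ (coeff r i ℤ.+ coeff s i)       ≡⟨ cong (λ z → coeff p i ℤ.+ z) (coeff-+ r s i) ⟨
  coeff p i ℤ.+ coeff (r +ᴾ s) i                ≡⟨ coeff-+ p (r +ᴾ s) i ⟨
  coeff (p +ᴾ (r +ᴾ s)) i                       ∎
  where open ≡.≡-Reasoning

+ᴾ-comm : ∀ p r → p +ᴾ r ≈ r +ᴾ p
+ᴾ-comm p r = coeffwise λ i →
  ≡.trans (coeff-+ p r i)
    (≡.trans (ℤ.+-comm (coeff p i) (coeff r i)) (≡.sym (coeff-+ r p i)))

+ᴾ-identityʳ : ∀ p → p +ᴾ 0ᴾ ≈ p
+ᴾ-identityʳ p = +ᴾ-comm p 0ᴾ

-ᴾ-cong : ∀ {p r} → p ≈ r → -ᴾ p ≈ -ᴾ r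
-ᴾ-cong {p} {r} e = coeffwise λ i →
  ≡.trans (coeff-neg p i) (≡.trans (cong ℤ.-_ (coeff-≡ e i)) (≡.sym (coeff-neg r i)))

-ᴾ-inverseˡ : ∀ p → -ᴾ p +ᴾ p ≈ 0ᴾ
-ᴾ-inverseˡ p = coeffwise λ i →
  ≡.trans (coeff-+ (-ᴾ p) p i)
    (≡.trans (cong (ℤ._+ coeff p i) (coeff-neg p i)) (ℤ.+-inverseˡ (coeff p i)))

+ᴾ-isAbelianGroup : IsAbelianGroup _≈_ _+ᴾ_ 0ᴾ -ᴾ_
+ᴾ-isAbelianGroup = record
  { isGroup = record
    { isMonoid = record
      { isSemigroup = record
        { isMagma = record { isEquivalence = ≈-isEquivalence ; ∙-cong = +ᴾ-cong }
        ; assoc   = +ᴾ-assoc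
        }
      ; identity = (λ _ → ≈-refl) , +ᴾ-identityʳ
      }
    ; inverse = -ᴾ-inverseˡ , λ p → ≈-trans (+ᴾ-comm p (-ᴾ p)) (-ᴾ-inverseˡ p)
    ; ⁻¹-cong = -ᴾ-cong
    }
  ; comm = +ᴾ-comm
  }

+ᴾ-commutativeMonoid : CommutativeMonoid _ _
+ᴾ-commutativeMonoid = record
  { isCommutativeMonoid = IsAbelianGroup.isCommutativeMonoid +ᴾ-isAbelianGroup }

open CommutativeSemigroupProperties
  (CommutativeMonoid.commutativeSemigroup +ᴾ-commutativeMonoid)
  using (interchange; x∙yz≈y∙xz)

open SetoidReasoning (CommutativeMonoid.setoid +ᴾ-commutativeMonoid)

∷-cong : ∀ {c d p r} → c ≡ d → p ≈ r → c ∷ p ≈ d ∷ r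
∷-cong c≡d p≈r = coeffwise λ where
  zero    → c≡d
  (suc i) → coeff-≡ p≈r i

0∷[]≈0 : 0ℤ ∷ 0ᴾ ≈ 0ᴾ
0∷[]≈0 = coeffwise λ where
  zero    → ≡.refl
  (suc i) → ≡.refl

·-congˡ : ∀ c {p r} → p ≈ r → c · p ≈ c · r
·-congˡ c {p} {r} e = coeffwise λ i →
  ≡.trans (coeff-· c p i) (≡.trans (cong (c ℤ.*_) (coeff-≡ e i)) (≡.sym (coeff-· c r i)))

·-distribˡ : ∀ c p r → c · (p +ᴾ r) ≈ c · p +ᴾ c · r
·-distribˡ c []      r       = ≈-refl
·-distribˡ c (d ∷ p) []      = ≈-refl
·-distribˡ c (d ∷ p) (e ∷ r) = ∷-cong (ℤ.*-distribˡ-+ c d e) (·-distribˡ c p r)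

·-distribʳ : ∀ c d p → (c ℤ.+ d) · p ≈ c · p +ᴾ d · p
·-distribʳ c d []      = ≈-refl
·-distribʳ c d (e ∷ p) = ∷-cong (ℤ.*-distribʳ-+ e c d) (·-distribʳ c d p)

·-assoc : ∀ c d p → (c ℤ.* d) · p ≈ c · (d · p)
·-assoc c d []      = ≈-refl
·-assoc c d (e ∷ p) = ∷-cong (ℤ.*-assoc c d e) (·-assoc c d p)

0·p≈0 : ∀ p → 0ℤ · p ≈ 0ᴾ
0·p≈0 p = coeffwise (coeff-· 0ℤ p)

1·p≈p : ∀ p → 1ℤ · p ≈ p
1·p≈p p = coeffwise λ i → ≡.trans (coeff-· 1ℤ p i) (ℤ.*-identityˡ (coeff p i))

*ᴾ-distribʳ : ∀ s p r → (p +ᴾ r) *ᴾ s ≈ p *ᴾ s +ᴾ r *ᴾ s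
*ᴾ-distribʳ s []      r       = ≈-refl
*ᴾ-distribʳ s (c ∷ p) []      = ≈-sym (+ᴾ-identityʳ _)
*ᴾ-distribʳ s (c ∷ p) (d ∷ r) = begin
  (c ℤ.+ d) · s +ᴾ (0ℤ ∷ (p +ᴾ r) *ᴾ s)
    ≈⟨ +ᴾ-cong (·-distribʳ c d s) (∷-cong ≡.refl (*ᴾ-distribʳ s p r)) ⟩
  (c · s +ᴾ d · s) +ᴾ ((0ℤ ∷ p *ᴾ s) +ᴾ (0ℤ ∷ r *ᴾ s))
    ≈⟨ interchange (c · s) (d · s) (0ℤ ∷ p *ᴾ s) (0ℤ ∷ r *ᴾ s) ⟩
  (c · s +ᴾ (0ℤ ∷ p *ᴾ s)) +ᴾ (d · s +ᴾ (0ℤ ∷ r *ᴾ s)) ∎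

*ᴾ-congˡ : ∀ p {r s} → r ≈ s → p *ᴾ r ≈ p *ᴾ s
*ᴾ-congˡ []      e = ≈-refl
*ᴾ-congˡ (c ∷ p) e = +ᴾ-cong (·-congˡ c e) (∷-cong ≡.refl (*ᴾ-congˡ p e))

*ᴾ-zeroʳ : ∀ p → p *ᴾ 0ᴾ ≈ 0ᴾ
*ᴾ-zeroʳ []      = ≈-refl
*ᴾ-zeroʳ (c ∷ p) = ≈-trans (∷-cong ≡.refl (*ᴾ-zeroʳ p)) 0∷[]≈0

*ᴾ-∷ : ∀ p d r → p *ᴾ (d ∷ r) ≈ d · p +ᴾ (0ℤ ∷ p *ᴾ r)
*ᴾ-∷ []      d r = ≈-sym 0∷[]≈0
*ᴾ-∷ (c ∷ p) d r = ∷-cong (cong (ℤ._+ 0ℤ) (ℤ.*-comm c d)) (begin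
  c · r +ᴾ p *ᴾ (d ∷ r)               ≈⟨ +ᴾ-cong ≈-refl (*ᴾ-∷ p d r) ⟩
  c · r +ᴾ (d · p +ᴾ (0ℤ ∷ p *ᴾ r))   ≈⟨ x∙yz≈y∙xz (c · r) (d · p) (0ℤ ∷ p *ᴾ r) ⟩
  d · p +ᴾ (c · r +ᴾ (0ℤ ∷ p *ᴾ r))   ∎)

*ᴾ-comm : ∀ p r → p *ᴾ r ≈ r *ᴾ p
*ᴾ-comm []      r = ≈-sym (*ᴾ-zeroʳ r)
*ᴾ-comm (c ∷ p) r = begin
  c · r +ᴾ (0ℤ ∷ p *ᴾ r)   ≈⟨ +ᴾ-cong ≈-refl (∷-cong ≡.refl (*ᴾ-comm p r)) ⟩
  c · r +ᴾ (0ℤ ∷ r *ᴾ p)   ≈⟨ *ᴾ-∷ r c p ⟨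
  r *ᴾ (c ∷ p)             ∎

*ᴾ-cong : ∀ {p p′ r r′} → p ≈ p′ → r ≈ r′ → p *ᴾ r ≈ p′ *ᴾ r′
*ᴾ-cong {p} {p′} {r} {r′} e f = begin
  p *ᴾ r     ≈⟨ *ᴾ-congˡ p f ⟩
  p *ᴾ r′    ≈⟨ *ᴾ-comm p r′ ⟩
  r′ *ᴾ p    ≈⟨ *ᴾ-congˡ r′ e ⟩
  r′ *ᴾ p′   ≈⟨ *ᴾ-comm r′ p′ ⟩
  p′ *ᴾ r′   ∎

·-*ᴾ-assoc : ∀ c p r → (c · p) *ᴾ r ≈ c · (p *ᴾ r)
·-*ᴾ-assoc c []      r = ≈-refl
·-*ᴾ-assoc c (d ∷ p) r = begin
  (c ℤ.* d) · r +ᴾ (0ℤ ∷ (c · p) *ᴾ r)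
    ≈⟨ +ᴾ-cong (·-assoc c d r) (∷-cong (≡.sym (ℤ.*-zeroʳ c)) (·-*ᴾ-assoc c p r)) ⟩
  c · (d · r) +ᴾ c · (0ℤ ∷ p *ᴾ r)
    ≈⟨ ·-distribˡ c (d · r) (0ℤ ∷ p *ᴾ r) ⟨
  c · (d · r +ᴾ (0ℤ ∷ p *ᴾ r)) ∎

*ᴾ-assoc : ∀ p r s → (p *ᴾ r) *ᴾ s ≈ p *ᴾ (r *ᴾ s)
*ᴾ-assoc []      r s = ≈-refl
*ᴾ-assoc (c ∷ p) r s = begin
  (c · r +ᴾ (0ℤ ∷ p *ᴾ r)) *ᴾ s
    ≈⟨ *ᴾ-distribʳ s (c · r) (0ℤ ∷ p *ᴾ r) ⟩
  (c · r) *ᴾ s +ᴾ (0ℤ · s +ᴾ (0ℤ ∷ (p *ᴾ r) *ᴾ s))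
    ≈⟨ +ᴾ-cong (·-*ᴾ-assoc c r s) (+ᴾ-cong (0·p≈0 s) (∷-cong ≡.refl (*ᴾ-assoc p r s))) ⟩
  c · (r *ᴾ s) +ᴾ (0ℤ ∷ p *ᴾ (r *ᴾ s)) ∎

*ᴾ-identityˡ : ∀ p → 1ᴾ *ᴾ p ≈ p
*ᴾ-identityˡ p = begin
  1ℤ · p +ᴾ (0ℤ ∷ [])   ≈⟨ +ᴾ-cong (1·p≈p p) 0∷[]≈0 ⟩
  p +ᴾ 0ᴾ               ≈⟨ +ᴾ-identityʳ p ⟩
  p                     ∎

*ᴾ-distribˡ : ∀ s p r → s *ᴾ (p +ᴾ r) ≈ s *ᴾ p +ᴾ s *ᴾ r
*ᴾ-distribˡ s p r = begin
  s *ᴾ (p +ᴾ r)      ≈⟨ *ᴾ-comm s (p +ᴾ r) ⟩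
  (p +ᴾ r) *ᴾ s      ≈⟨ *ᴾ-distribʳ s p r ⟩
  p *ᴾ s +ᴾ r *ᴾ s   ≈⟨ +ᴾ-cong (*ᴾ-comm p s) (*ᴾ-comm r s) ⟩
  s *ᴾ p +ᴾ s *ᴾ r   ∎

ℤ[q] : CommutativeRing _ _
ℤ[q] = record
  { isCommutativeRing = record
    { isRing = record
      { +-isAbelianGroup = +ᴾ-isAbelianGroup
      ; *-cong           = *ᴾ-cong
      ; *-assoc          = *ᴾ-assoc
      ; *-identity       = *ᴾ-identityˡ , λ p → ≈-trans (*ᴾ-comm p 1ᴾ) (*ᴾ-identityˡ p)
      ; distrib          = *ᴾ-distribˡ , *ᴾ-distribʳ
      }
    ; *-comm = *ᴾ-comm
    }
  }

open CommutativeRing ℤ[q] public using () renaming (_-_ to _-ᴾ_)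
open RawSemiringDefinitions (Semiring.rawSemiring (CommutativeRing.semiring ℤ[q])) public
  using () renaming (_^_ to _^ᴾ_; _∣_ to _∣ᴾ_)
open SumProperties (CommutativeRing.+-commutativeMonoid ℤ[q]) public
  using (sum; sum-syntax)

[_] : ℕ → Poly
[ n ] = ∑[ i < n ] (q ^ᴾ toℕ i)

[_]! : ℕ → Poly
[ zero  ]! = 1ᴾ
[ suc n ]! = [ n ]! *ᴾ [ suc n ]

[1+n]≈1+q[n] : ∀ n → [ suc n ] ≈ 1ᴾ +ᴾ q *ᴾ [ n ]
[1+n]≈1+q[n] n =
  +ᴾ-cong ≈-refl (≈-sym (*-distribˡ-sum {n} q (λ i → q ^ᴾ toℕ i)))
  where
  open SemiringSumProperties (CommutativeRing.semiring ℤ[q]) using (*-distribˡ-sum)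

[m+n]≈[m]+qᵐ[n] : ∀ m n → [ m + n ] ≈ [ m ] +ᴾ q ^ᴾ m *ᴾ [ n ]
[m+n]≈[m]+qᵐ[n] zero    n = ≈-sym (*ᴾ-identityˡ [ n ])
[m+n]≈[m]+qᵐ[n] (suc m) n = begin
  [ suc (m + n) ]
    ≈⟨ [1+n]≈1+q[n] (m + n) ⟩
  1ᴾ +ᴾ q *ᴾ [ m + n ]
    ≈⟨ +ᴾ-cong {1ᴾ} ≈-refl (*ᴾ-congˡ q ([m+n]≈[m]+qᵐ[n] m n)) ⟩
  1ᴾ +ᴾ q *ᴾ ([ m ] +ᴾ q ^ᴾ m *ᴾ [ n ])
    ≈⟨ +ᴾ-cong {1ᴾ} ≈-refl (*ᴾ-distribˡ q [ m ] (q ^ᴾ m *ᴾ [ n ])) ⟩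
  1ᴾ +ᴾ (q *ᴾ [ m ] +ᴾ q *ᴾ (q ^ᴾ m *ᴾ [ n ]))
    ≈⟨ +ᴾ-assoc 1ᴾ (q *ᴾ [ m ]) (q *ᴾ (q ^ᴾ m *ᴾ [ n ])) ⟨
  (1ᴾ +ᴾ q *ᴾ [ m ]) +ᴾ q *ᴾ (q ^ᴾ m *ᴾ [ n ])
    ≈⟨ +ᴾ-cong ([1+n]≈1+q[n] m) (*ᴾ-assoc q (q ^ᴾ m) [ n ]) ⟨
  [ suc m ] +ᴾ q ^ᴾ suc m *ᴾ [ n ] ∎

[m]![n]!∣[m+n]! : ∀ m n → [ m ]! *ᴾ [ n ]! ∣ᴾ [ m + n ]!
[m]![n]!∣[m+n]! zero    n       =
  1ᴾ , ≈-trans (*ᴾ-identityˡ _) (*ᴾ-identityˡ _)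
[m]![n]!∣[m+n]! (suc m) zero    = 1ᴾ , (begin
  1ᴾ *ᴾ ([ suc m ]! *ᴾ 1ᴾ)   ≈⟨ *ᴾ-identityˡ _ ⟩
  [ suc m ]! *ᴾ 1ᴾ           ≈⟨ *ᴾ-comm [ suc m ]! 1ᴾ ⟩
  1ᴾ *ᴾ [ suc m ]!           ≈⟨ *ᴾ-identityˡ _ ⟩
  [ suc m ]!                 ≡⟨ cong (λ l → [ suc l ]!) (ℕ.+-identityʳ m) ⟨
  [ suc m + zero ]!          ∎)
[m]![n]!∣[m+n]! (suc m) (suc n)
  with [m]![n]!∣[m+n]! m (suc n) | [m]![n]!∣[m+n]! (suc m) n
... | c , c-eq | d , d-eq = c +ᴾ Q *ᴾ d , (begin
  (c +ᴾ Q *ᴾ d) *ᴾ ((A *ᴾ x) *ᴾ (B *ᴾ y))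
    ≈⟨ *ᴾ-distribʳ _ c (Q *ᴾ d) ⟩
  c *ᴾ ((A *ᴾ x) *ᴾ (B *ᴾ y)) +ᴾ (Q *ᴾ d) *ᴾ ((A *ᴾ x) *ᴾ (B *ᴾ y))
    ≈⟨ +ᴾ-cong left right ⟩
  N *ᴾ x +ᴾ N *ᴾ (Q *ᴾ y)
    ≈⟨ *ᴾ-distribˡ N x (Q *ᴾ y) ⟨
  N *ᴾ (x +ᴾ Q *ᴾ y)
    ≈⟨ *ᴾ-congˡ N ([m+n]≈[m]+qᵐ[n] (suc m) (suc n)) ⟨
  N *ᴾ [ suc m + suc n ] ∎)
  where
  open CommutativeSemigroupProperties (CommutativeRing.*-commutativeSemigroup ℤ[q])
    using () renaming (xy∙z≈xz∙y to ps-r≈pr-s; interchange to *-interchange)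

  Q = q ^ᴾ suc m
  A = [ m ]!
  B = [ n ]!
  N = [ m + suc n ]!
  x = [ suc m ]
  y = [ suc n ]

  left : c *ᴾ ((A *ᴾ x) *ᴾ (B *ᴾ y)) ≈ N *ᴾ x
  left = begin
    c *ᴾ ((A *ᴾ x) *ᴾ (B *ᴾ y))   ≈⟨ *ᴾ-congˡ c (ps-r≈pr-s A x (B *ᴾ y)) ⟩
    c *ᴾ ((A *ᴾ (B *ᴾ y)) *ᴾ x)   ≈⟨ *ᴾ-assoc c (A *ᴾ (B *ᴾ y)) x ⟨
    (c *ᴾ (A *ᴾ (B *ᴾ y))) *ᴾ x   ≈⟨ *ᴾ-cong c-eq ≈-refl ⟩
    N *ᴾ x                        ∎

  right : (Q *ᴾ d) *ᴾ ((A *ᴾ x) *ᴾ (B *ᴾ y)) ≈ N *ᴾ (Q *ᴾ y)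
  right = begin
    (Q *ᴾ d) *ᴾ ((A *ᴾ x) *ᴾ (B *ᴾ y))   ≈⟨ *ᴾ-cong (*ᴾ-comm Q d) (≈-sym (*ᴾ-assoc (A *ᴾ x) B y)) ⟩
    (d *ᴾ Q) *ᴾ (((A *ᴾ x) *ᴾ B) *ᴾ y)   ≈⟨ *-interchange d Q ((A *ᴾ x) *ᴾ B) y ⟩
    (d *ᴾ ((A *ᴾ x) *ᴾ B)) *ᴾ (Q *ᴾ y)   ≈⟨ *ᴾ-cong d-eq ≈-refl ⟩
    [ suc m + n ]! *ᴾ (Q *ᴾ y)           ≡⟨ cong (λ l → [ l ]! *ᴾ (Q *ᴾ y)) (ℕ.+-suc m n) ⟨
    N *ᴾ (Q *ᴾ y)                        ∎

[k]![n∸k]!∣[n]! : ∀ {n k} → k ≤ n → [ k ]! *ᴾ [ n ∸ k ]! ∣ᴾ [ n ]!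
[k]![n∸k]!∣[n]! {n} {k} k≤n =
  ≡.subst (λ l → [ k ]! *ᴾ [ n ∸ k ]! ∣ᴾ [ l ]!) (ℕ.m+[n∸m]≡n k≤n)
    ([m]![n]!∣[m+n]! k (n ∸ k))

-- The quotient [n]! / ([k]! [n-k]!) exists in ℤ[q] by the lemma above, and it
-- is unique up to _≈_ because the divisor has constant term 1.
_choose_ : ℕ → ℕ → Poly
n choose k with k ≤? n
... | yes k≤n = quotient ([k]![n∸k]!∣[n]! k≤n)
  where open _∣ʳ_
... | no  _   = 0ᴾ

ξ : ℕ → ℕ
ξ n = n ∸ 2 * ⌊ n /2⌋

module _ (a b : ℕ) where

  multiplier : ℕ → Poly
  multiplier n with parity n
  ... | 0ℙ = constant (ℤ.+ a)
  ... | 1ℙ = constant (ℤ.+ b)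

  biperiodic : Poly → Poly → ℕ → Poly
  biperiodic x₀ x₁ 0             = x₀
  biperiodic x₀ x₁ 1             = x₁
  biperiodic x₀ x₁ (suc (suc n)) =
    multiplier (suc (suc n)) *ᴾ biperiodic x₀ x₁ (suc n) +ᴾ q ^ᴾ n *ᴾ biperiodic x₀ x₁ n

  F F̂ : ℕ → Poly
  F = biperiodic 0ᴾ 1ᴾ
  F̂ = biperiodic 1ᴾ 0ᴾ

{-# OPTIONS --safe #-}
module Submission where

-- For fixed n, the left-hand side D(k) is a Casoratian of the recurrence, so it
-- satisfies that same recurrence, D(k+2) = mₙ₊ₖ D(k+1) + qⁿ⁺ᵏ D(k), where mᵢ is
-- a or b according to the parity of i, with D(0) = 0; a first-order recurrence
-- in n gives D(1) = (-1)ⁿ⁺¹ q^(n choose 2).  The sum over j obeys the same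
-- recurrence term by term: in Pascal's rule
-- [k+1-j, j] = [k-j, j] + q^(k+1-2j) [k-j, j-1], the first summand yields the
-- j-th term for k+1 and the second one the (j-1)-st term for k.

open import Algebra.Bundles using (CommutativeRing)
open import Algebra.Definitions.RawMagma using (module _∣ʳ_)
import Algebra.Properties.CommutativeMonoid.Sum as SumProperties
import Algebra.Properties.Group as GroupProperties
import Algebra.Properties.Ring as RingProperties
import Algebra.Properties.Semiring.Exp as ExpProperties
import Algebra.Properties.Semiring.Sum as SemiringSumProperties
import Algebra.Solver.Ring.NaturalCoefficients.Default as SemiringSolver
open import Data.Fin using (toℕ)
open import Data.Integer as ℤ using (+_; 0ℤ; 1ℤ; -1ℤ)
import Data.Integer.Properties as ℤ
open import Data.List using ([]; _∷_)
open import Data.Nat using (ℕ; zero; suc; _+_; _*_; _∸_; _≤_; _<_; _≤?_; z≤n; s≤s; ⌊_/2⌋; NonZero; >-nonZero)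
open import Data.Nat.Combinatorics using (_C_; nC1≡n; nCk+nC[k+1]≡[n+1]C[k+1])
import Data.Nat.Properties as ℕ
import Data.Nat.Solver as ℕSolver
open import Data.Product using (_×_; _,_)
open import Data.Sum using (_⊎_; inj₁; inj₂)
open import Function using (_∘_)
open import Relation.Binary.PropositionalEquality as ≡ using (_≡_; cong; cong₂; module ≡-Reasoning)
open import Relation.Nullary using (yes; no; contradiction)
import Relation.Binary.Reasoning.Setoid as SetoidReasoning
open import Defs

open CommutativeRing ℤ[q]
  using (setoid; commutativeSemiring; semiring; ring; +-group; +-commutativeMonoid; -‿inverseʳ)
  renaming ( refl to ≈-refl; sym to ≈-sym; trans to ≈-trans
           ; +-congˡ to +ᴾ-congˡ; +-congʳ to +ᴾ-congʳ; *-congʳ to *ᴾ-congʳ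
           ; *-identityʳ to *ᴾ-identityʳ)
open ExpProperties semiring using () renaming (^-homo-* to ^ᴾ-homo-*)
open SemiringSolver commutativeSemiring using (solve; con; _:+_; _:*_; _:=_)

-- Cancelling polynomials with constant term 1.

coeff₀-* : ∀ p r → coeff (p *ᴾ r) 0 ≡ coeff p 0 ℤ.* coeff r 0
coeff₀-* []      r = ≡.sym (ℤ.*-zeroˡ (coeff r 0))
coeff₀-* (c ∷ p) r = begin
  coeff (c · r +ᴾ (0ℤ ∷ p *ᴾ r)) 0   ≡⟨ coeff-+ (c · r) _ 0 ⟩
  coeff (c · r) 0 ℤ.+ 0ℤ             ≡⟨ ℤ.+-identityʳ _ ⟩
  coeff (c · r) 0                    ≡⟨ coeff-· c r 0 ⟩
  c ℤ.* coeff r 0                    ∎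
  where open ≡-Reasoning

coeff₀-[1+n] : ∀ n → coeff [ suc n ] 0 ≡ 1ℤ
coeff₀-[1+n] n = begin
  coeff [ suc n ] 0                 ≡⟨ coeff-≡ ([1+n]≈1+q[n] n) 0 ⟩
  coeff (1ᴾ +ᴾ q *ᴾ [ n ]) 0        ≡⟨ coeff-+ 1ᴾ (q *ᴾ [ n ]) 0 ⟩
  1ℤ ℤ.+ coeff (q *ᴾ [ n ]) 0       ≡⟨ cong (λ z → 1ℤ ℤ.+ z) (coeff₀-* q [ n ]) ⟩
  1ℤ ℤ.+ 0ℤ ℤ.* coeff [ n ] 0       ≡⟨ cong (λ z → 1ℤ ℤ.+ z) (ℤ.*-zeroˡ (coeff [ n ] 0)) ⟩
  1ℤ                                ∎
  where open ≡-Reasoning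

coeff₀-[n]! : ∀ n → coeff [ n ]! 0 ≡ 1ℤ
coeff₀-[n]! zero    = ≡.refl
coeff₀-[n]! (suc n) =
  ≡.trans (coeff₀-* [ n ]! [ suc n ]) (cong₂ ℤ._*_ (coeff₀-[n]! n) (coeff₀-[1+n] n))

-- The constant term of the product is that of `x`, so it vanishes. The product is then `q` times
-- `p` times the tail of `x`, and induction applies to the tail.
*ᴾ-cancelˡ-0 : ∀ p x → coeff p 0 ≡ 1ℤ → p *ᴾ x ≈ 0ᴾ → x ≈ 0ᴾ
*ᴾ-cancelˡ-0 p []      _    _ = ≈-refl
*ᴾ-cancelˡ-0 p (d ∷ x) p₀≡1 e = coeffwise λ where
    zero    → d≡0
    (suc i) → coeff-≡ (*ᴾ-cancelˡ-0 p x p₀≡1 (coeffwise px≡0)) i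
  where
  open ≡-Reasoning

  d≡0 : d ≡ 0ℤ
  d≡0 = begin
    d                        ≡⟨ ℤ.*-identityˡ d ⟨
    1ℤ ℤ.* d                 ≡⟨ cong (ℤ._* d) p₀≡1 ⟨
    coeff p 0 ℤ.* d          ≡⟨ coeff₀-* p (d ∷ x) ⟨
    coeff (p *ᴾ (d ∷ x)) 0   ≡⟨ coeff-≡ e 0 ⟩
    0ℤ                       ∎

  px≡0 : ∀ i → coeff (p *ᴾ x) i ≡ 0ℤ
  px≡0 i = begin
    coeff (p *ᴾ x) i
      ≡⟨ ℤ.+-identityˡ _ ⟨
    0ℤ ℤ.+ coeff (p *ᴾ x) i
      ≡⟨ cong (ℤ._+ coeff (p *ᴾ x) i) (ℤ.*-zeroˡ (coeff p (suc i))) ⟨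
    0ℤ ℤ.* coeff p (suc i) ℤ.+ coeff (p *ᴾ x) i
      ≡⟨ cong (λ z → z ℤ.* coeff p (suc i) ℤ.+ coeff (p *ᴾ x) i) d≡0 ⟨
    d ℤ.* coeff p (suc i) ℤ.+ coeff (p *ᴾ x) i
      ≡⟨ cong (ℤ._+ coeff (p *ᴾ x) i) (coeff-· d p (suc i)) ⟨
    coeff (d · p) (suc i) ℤ.+ coeff (p *ᴾ x) i
      ≡⟨ coeff-+ (d · p) (0ℤ ∷ p *ᴾ x) (suc i) ⟨
    coeff (d · p +ᴾ (0ℤ ∷ p *ᴾ x)) (suc i)
      ≡⟨ coeff-≡ (*ᴾ-∷ p d x) (suc i) ⟨
    coeff (p *ᴾ (d ∷ x)) (suc i)
      ≡⟨ coeff-≡ e (suc i) ⟩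
    0ℤ ∎

open SetoidReasoning setoid

*ᴾ-cancelˡ : ∀ p {x y} → coeff p 0 ≡ 1ℤ → p *ᴾ x ≈ p *ᴾ y → x ≈ y
*ᴾ-cancelˡ p {x} {y} p₀≡1 e =
  GroupProperties.x∙y⁻¹≈ε⇒x≈y +-group x y (*ᴾ-cancelˡ-0 p (x -ᴾ y) p₀≡1 (begin
    p *ᴾ (x -ᴾ y)            ≈⟨ *ᴾ-distribˡ p x (-ᴾ y) ⟩
    p *ᴾ x +ᴾ p *ᴾ (-ᴾ y)    ≈⟨ +ᴾ-congʳ e ⟩
    p *ᴾ y +ᴾ p *ᴾ (-ᴾ y)    ≈⟨ *ᴾ-distribˡ p y (-ᴾ y) ⟨
    p *ᴾ (y -ᴾ y)            ≈⟨ *ᴾ-congˡ p (-‿inverseʳ y) ⟩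
    p *ᴾ 0ᴾ                  ≈⟨ *ᴾ-zeroʳ p ⟩
    0ᴾ                       ∎))

-- The q-binomial coefficients and Pascal's rule.

coeff₀-[k]![m]! : ∀ k m → coeff ([ k ]! *ᴾ [ m ]!) 0 ≡ 1ℤ
coeff₀-[k]![m]! k m =
  ≡.trans (coeff₀-* [ k ]! [ m ]!) (cong₂ ℤ._*_ (coeff₀-[n]! k) (coeff₀-[n]! m))

n<k⇒nchoosek≡0 : ∀ {n k} → n < k → n choose k ≡ 0ᴾ
n<k⇒nchoosek≡0 {n} {k} n<k with k ≤? n
... | yes k≤n = contradiction n<k (ℕ.≤⇒≯ k≤n)
... | no  _   = ≡.refl

choose-! : ∀ {n k} → k ≤ n → n choose k *ᴾ ([ k ]! *ᴾ [ n ∸ k ]!) ≈ [ n ]!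
choose-! {n} {k} k≤n with k ≤? n
... | yes k≤n′ = _∣ʳ_.equality ([k]![n∸k]!∣[n]! k≤n′)
... | no  k≰n  = contradiction k≤n k≰n

[k+m]choosek-! : ∀ k m → (k + m) choose k *ᴾ ([ k ]! *ᴾ [ m ]!) ≈ [ k + m ]!
[k+m]choosek-! k m = ≡.subst
  (λ l → (k + m) choose k *ᴾ ([ k ]! *ᴾ [ l ]!) ≈ [ k + m ]!)
  (ℕ.m+n∸m≡n k m) (choose-! (ℕ.m≤m+n k m))

-- This puts the first summand of Pascal's rule over the denominator `[ suc k ]! *ᴾ [ m ]!` of the
-- left side. For `m = 0` the coefficient is out of range and `[ 0 ]` is zero.
[k+m]choose[1+k]-! : ∀ k m →
  (k + m) choose (suc k) *ᴾ ([ suc k ]! *ᴾ [ m ]!) ≈ [ k + m ]! *ᴾ [ m ]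
[k+m]choose[1+k]-! k zero    = begin
  (k + 0) choose (suc k) *ᴾ D   ≡⟨ cong (_*ᴾ D) (n<k⇒nchoosek≡0 (s≤s (ℕ.≤-reflexive (ℕ.+-identityʳ k)))) ⟩
  0ᴾ                            ≈⟨ *ᴾ-zeroʳ [ k + 0 ]! ⟨
  [ k + 0 ]! *ᴾ 0ᴾ              ∎
  where D = [ suc k ]! *ᴾ 1ᴾ
[k+m]choose[1+k]-! k (suc m) rewrite ℕ.+-suc k m = begin
  c *ᴾ ([ suc k ]! *ᴾ ([ m ]! *ᴾ [ suc m ]))
    ≈⟨ solve 4 (λ c x y z → c :* (x :* (y :* z)) := c :* (x :* y) :* z) ≈-refl
         c [ suc k ]! [ m ]! [ suc m ] ⟩
  c *ᴾ ([ suc k ]! *ᴾ [ m ]!) *ᴾ [ suc m ]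
    ≈⟨ *ᴾ-congʳ ([k+m]choosek-! (suc k) m) ⟩
  [ suc k + m ]! *ᴾ [ suc m ] ∎
  where c = suc (k + m) choose suc k

nchoose0≈1 : ∀ n → n choose 0 ≈ 1ᴾ
nchoose0≈1 n = *ᴾ-cancelˡ D (coeff₀-[k]![m]! 0 n) (begin
  D *ᴾ n choose 0   ≈⟨ *ᴾ-comm D (n choose 0) ⟩
  n choose 0 *ᴾ D   ≈⟨ [k+m]choosek-! 0 n ⟩
  [ n ]!            ≈⟨ *ᴾ-identityˡ [ n ]! ⟨
  D                 ≈⟨ *ᴾ-identityʳ D ⟨
  D *ᴾ 1ᴾ           ∎)
  where D = [ 0 ]! *ᴾ [ n ]!

-- A `choose` is known only through its product with the denominator, so both sides are multiplied
-- by `D` and `D` is cancelled at the end. What remains is the splitting of `[ m + suc k ]`.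
choose-pascal : ∀ k m →
  suc (k + m) choose suc k ≈ (k + m) choose suc k +ᴾ q ^ᴾ m *ᴾ (k + m) choose k
choose-pascal k m = *ᴾ-cancelˡ D (coeff₀-[k]![m]! (suc k) m) (begin
  D *ᴾ suc (k + m) choose suc k
    ≈⟨ *ᴾ-comm D _ ⟩
  suc (k + m) choose suc k *ᴾ D
    ≈⟨ [k+m]choosek-! (suc k) m ⟩
  N *ᴾ [ suc (k + m) ]
    -- This order of the summands puts the factor `q ^ᴾ m` on `[ suc k ]`.
    ≡⟨ cong (λ l → N *ᴾ [ l ]) (ℕ.+-comm (suc k) m) ⟩
  N *ᴾ [ m + suc k ]
    ≈⟨ *ᴾ-congˡ N ([m+n]≈[m]+qᵐ[n] m (suc k)) ⟩
  N *ᴾ ([ m ] +ᴾ Q *ᴾ [ suc k ])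
    ≈⟨ solve 4 (λ n x y z → n :* (x :+ y :* z) := n :* x :+ y :* (n :* z)) ≈-refl
         N [ m ] Q [ suc k ] ⟩
  N *ᴾ [ m ] +ᴾ Q *ᴾ (N *ᴾ [ suc k ])
    ≈⟨ +ᴾ-cong ([k+m]choose[1+k]-! k m) (*ᴾ-congˡ Q (*ᴾ-congʳ ([k+m]choosek-! k m))) ⟨
  c *ᴾ D +ᴾ Q *ᴾ (d *ᴾ ([ k ]! *ᴾ [ m ]!) *ᴾ [ suc k ])
    ≈⟨ solve 6 (λ c d Q x y z →
           c :* (x :* z :* y) :+ Q :* (d :* (x :* y) :* z) := x :* z :* y :* (c :+ Q :* d)) ≈-refl
         c d Q [ k ]! [ m ]! [ suc k ] ⟩
  D *ᴾ (c +ᴾ Q *ᴾ d) ∎)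
  where
  D = [ suc k ]! *ᴾ [ m ]!
  N = [ k + m ]!
  Q = q ^ᴾ m
  c = (k + m) choose suc k
  d = (k + m) choose k

-- Parity and the exponents of a and b.

ξ[2+n]≡ξ[n] : ∀ n → ξ (suc (suc n)) ≡ ξ n
ξ[2+n]≡ξ[n] n = cong (suc (suc n) ∸_) (ℕ.*-suc 2 ⌊ n /2⌋)

-- Here k is the k ∸ 1 of the theorem; the exponents of a and b in its j-th term are
-- exponent (n + 1) k ∸ j and exponent n k ∸ j.
exponent : ℕ → ℕ → ℕ
exponent n k = ⌊ k /2⌋ + ξ (suc k + 1) * ξ n

exponent-2+ˡ : ∀ n k → exponent (suc (suc n)) k ≡ exponent n k
exponent-2+ˡ n k = cong (λ x → ⌊ k /2⌋ + ξ (suc k + 1) * x) (ξ[2+n]≡ξ[n] n)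

exponent-2+ʳ : ∀ n k → exponent n (suc (suc k)) ≡ suc (exponent n k)
exponent-2+ʳ n k = cong (λ x → suc ⌊ k /2⌋ + x * ξ n) (ξ[2+n]≡ξ[n] (suc k + 1))

⌊k/2⌋≤exponent : ∀ n k → ⌊ k /2⌋ ≤ exponent n k
⌊k/2⌋≤exponent n k = ℕ.m≤m+n ⌊ k /2⌋ _

-- If `j + j ≤ k`, halving would give `j ≤ ⌊ k /2⌋`. The hypothesis also makes `j` positive, which
-- matters because `∸` truncates.
⌊k/2⌋<j⇒k∸j<j : ∀ {k j} → ⌊ k /2⌋ < j → k ∸ j < j
⌊k/2⌋<j⇒k∸j<j {k} {j} h =
  ℕ.m<n+o⇒m∸n<o k j {{>-nonZero (ℕ.≤-<-trans z≤n h)}} (ℕ.≰⇒> λ j+j≤k →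
    contradiction (≡.subst (_≤ ⌊ k /2⌋) (≡.sym (ℕ.n≡⌊n+n/2⌋ j)) (ℕ.⌊n/2⌋-mono j+j≤k))
      (ℕ.<⇒≱ h))

j≤⌊k/2⌋⇒j+j≤k : ∀ {k j} → j ≤ ⌊ k /2⌋ → j + j ≤ k
j≤⌊k/2⌋⇒j+j≤k {k} {j} h = ≡.subst (j + j ≤_) (ℕ.⌊n/2⌋+⌈n/2⌉≡n k)
  (ℕ.+-mono-≤ h (ℕ.≤-trans h (ℕ.⌊n/2⌋≤⌈n/2⌉ k)))

-- Finite sums.

∑-last : ∀ n (f : ℕ → Poly) →
  ∑[ i < suc n ] f (toℕ i) ≈ ∑[ i < n ] f (toℕ i) +ᴾ f n
∑-last zero    f = +ᴾ-comm (f 0) 0ᴾ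
∑-last (suc n) f = begin
  f 0 +ᴾ ∑[ i < suc n ] f (suc (toℕ i))
    ≈⟨ +ᴾ-congˡ {f 0} (∑-last n (f ∘ suc)) ⟩
  f 0 +ᴾ (∑[ i < n ] f (suc (toℕ i)) +ᴾ f (suc n))
    ≈⟨ +ᴾ-assoc (f 0) _ (f (suc n)) ⟨
  f 0 +ᴾ ∑[ i < n ] f (suc (toℕ i)) +ᴾ f (suc n) ∎

∑-linear : ∀ n x y (f g : ℕ → Poly) →
  ∑[ i < n ] (x *ᴾ f (toℕ i) +ᴾ y *ᴾ g (toℕ i))
    ≈ x *ᴾ ∑[ i < n ] f (toℕ i) +ᴾ y *ᴾ ∑[ i < n ] g (toℕ i)
∑-linear n x y f g = begin
  ∑[ i < n ] (x *ᴾ f (toℕ i) +ᴾ y *ᴾ g (toℕ i))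
    ≈⟨ SumProperties.∑-distrib-+ +-commutativeMonoid {n} (λ i → x *ᴾ f (toℕ i)) (λ i → y *ᴾ g (toℕ i)) ⟩
  ∑[ i < n ] (x *ᴾ f (toℕ i)) +ᴾ ∑[ i < n ] (y *ᴾ g (toℕ i))
    ≈⟨ +ᴾ-cong (*-distribˡ-sum {n} x (f ∘ toℕ)) (*-distribˡ-sum {n} y (g ∘ toℕ)) ⟨
  x *ᴾ ∑[ i < n ] f (toℕ i) +ᴾ y *ᴾ ∑[ i < n ] g (toℕ i) ∎
  where open SemiringSumProperties semiring using (*-distribˡ-sum)

-- The Casoratian of `F` and `F̂`.

module _ (a b : ℕ) where

  -- The multiplier at index `n + k + 2` is the one at `n + k`, because the parity is the same.
  biperiodic-+ : ∀ x₀ x₁ n k → let x = biperiodic a b x₀ x₁ in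
    x (n + suc (suc k)) ≡ multiplier a b (n + k) *ᴾ x (n + suc k) +ᴾ q ^ᴾ (n + k) *ᴾ x (n + k)
  biperiodic-+ x₀ x₁ n k rewrite ℕ.+-suc n (suc k) | ℕ.+-suc n k = ≡.refl

  -- A product with -1 in place of a subtraction makes the identities below
  -- semiring identities modulo 1 + (-1) ≈ 0 and (-1)(-1) ≈ 1.
  casoratian : ℕ → ℕ → Poly
  casoratian n k = F a b n *ᴾ F̂ a b (n + k) +ᴾ constant -1ℤ *ᴾ (F a b (n + k) *ᴾ F̂ a b n)

  1+[-1]≈0 : 1ᴾ +ᴾ constant -1ℤ ≈ 0ᴾ
  1+[-1]≈0 = 0∷[]≈0

  casoratian-0 : ∀ n → casoratian n 0 ≈ 0ᴾ
  casoratian-0 n rewrite ℕ.+-identityʳ n = begin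
    x *ᴾ y +ᴾ s *ᴾ (x *ᴾ y)
      ≈⟨ solve 3 (λ s x y → x :* y :+ s :* (x :* y) := (con 1 :+ s) :* (x :* y)) ≈-refl s x y ⟩
    (1ᴾ +ᴾ s) *ᴾ (x *ᴾ y)     ≈⟨ *ᴾ-congʳ 1+[-1]≈0 ⟩
    0ᴾ                        ∎
    where
    s = constant -1ℤ
    x = F a b n
    y = F̂ a b n

  casoratian-step : ∀ n k → casoratian n (suc (suc k)) ≈
    multiplier a b (n + k) *ᴾ casoratian n (suc k) +ᴾ q ^ᴾ (n + k) *ᴾ casoratian n k
  casoratian-step n k
    rewrite biperiodic-+ 0ᴾ 1ᴾ n k | biperiodic-+ 1ᴾ 0ᴾ n k =
    solve 9 (λ m Q s x y x₀ x₁ y₀ y₁ →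
        x :* (m :* y₁ :+ Q :* y₀) :+ s :* ((m :* x₁ :+ Q :* x₀) :* y)
          := m :* (x :* y₁ :+ s :* (x₁ :* y)) :+ Q :* (x :* y₀ :+ s :* (x₀ :* y)))
      ≈-refl (multiplier a b (n + k)) (q ^ᴾ (n + k)) (constant -1ℤ) (F a b n) (F̂ a b n)
      (F a b (n + k)) (F a b (n + suc k)) (F̂ a b (n + k)) (F̂ a b (n + suc k))

  -- Expanding the terms of index `n + 2` gives two multiples of `m *ᴾ x₁ *ᴾ y₁` that cancel; the
  -- rest is the previous Casoratian with its two products exchanged.
  casoratian-1-step : ∀ n →
    casoratian (suc n) 1 ≈ constant -1ℤ *ᴾ (q ^ᴾ n *ᴾ casoratian n 1)
  casoratian-1-step n rewrite ℕ.+-suc n 0 | ℕ.+-identityʳ n = begin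
    x₁ *ᴾ (m *ᴾ y₁ +ᴾ Q *ᴾ y₀) +ᴾ s *ᴾ ((m *ᴾ x₁ +ᴾ Q *ᴾ x₀) *ᴾ y₁)
      ≈⟨ solve 7 (λ m Q s x₀ x₁ y₀ y₁ →
           x₁ :* (m :* y₁ :+ Q :* y₀) :+ s :* ((m :* x₁ :+ Q :* x₀) :* y₁)
             := (con 1 :+ s) :* (m :* x₁ :* y₁) :+ (con 1 :* (Q :* x₁ :* y₀) :+ s :* Q :* x₀ :* y₁))
           ≈-refl m Q s x₀ x₁ y₀ y₁ ⟩
    -- The solver's `con 1` reappears as `s *ᴾ s`, which computes to `1ᴾ`; this lets a factor `s` be
    -- taken out of both remaining products.
    (1ᴾ +ᴾ s) *ᴾ (m *ᴾ x₁ *ᴾ y₁) +ᴾ (s *ᴾ s *ᴾ (Q *ᴾ x₁ *ᴾ y₀) +ᴾ s *ᴾ Q *ᴾ x₀ *ᴾ y₁)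
      ≈⟨ +ᴾ-congʳ (*ᴾ-congʳ {m *ᴾ x₁ *ᴾ y₁} 1+[-1]≈0) ⟩
    s *ᴾ s *ᴾ (Q *ᴾ x₁ *ᴾ y₀) +ᴾ s *ᴾ Q *ᴾ x₀ *ᴾ y₁
      ≈⟨ solve 6 (λ Q s x₀ x₁ y₀ y₁ →
           s :* s :* (Q :* x₁ :* y₀) :+ s :* Q :* x₀ :* y₁
             := s :* (Q :* (x₀ :* y₁ :+ s :* (x₁ :* y₀))))
           ≈-refl Q s x₀ x₁ y₀ y₁ ⟩
    s *ᴾ (Q *ᴾ (x₀ *ᴾ y₁ +ᴾ s *ᴾ (x₁ *ᴾ y₀))) ∎
    where
    s = constant -1ℤ
    Q = q ^ᴾ n
    m = multiplier a b (suc (suc n))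
    x₀ = F a b n
    x₁ = F a b (suc n)
    y₀ = F̂ a b n
    y₁ = F̂ a b (suc n)

  -- The exponent `n + 1` has the parity of n - 1 and stays a natural number at `n = 0`.
  prefactor : ℕ → Poly
  prefactor n = constant -1ℤ ^ᴾ (n + 1) *ᴾ q ^ᴾ (n C 2)

  -- Pascal's rule for ordinary binomials gives `suc n C 2 ≡ n + n C 2`.
  prefactor-step : ∀ n → prefactor (suc n) ≈ constant -1ℤ *ᴾ (q ^ᴾ n *ᴾ prefactor n)
  prefactor-step n = begin
    s *ᴾ S *ᴾ q ^ᴾ (suc n C 2)
      ≡⟨ cong (λ e → s *ᴾ S *ᴾ q ^ᴾ e) (nCk+nC[k+1]≡[n+1]C[k+1] n 1) ⟨
    s *ᴾ S *ᴾ q ^ᴾ (n C 1 + n C 2)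
      ≡⟨ cong (λ e → s *ᴾ S *ᴾ q ^ᴾ (e + n C 2)) (nC1≡n n) ⟩
    s *ᴾ S *ᴾ q ^ᴾ (n + n C 2)
      ≈⟨ *ᴾ-congˡ (s *ᴾ S) (^ᴾ-homo-* q n (n C 2)) ⟩
    s *ᴾ S *ᴾ (q ^ᴾ n *ᴾ q ^ᴾ (n C 2))
      ≈⟨ solve 4 (λ s S x y → s :* S :* (x :* y) := s :* (x :* (S :* y))) ≈-refl
           s S (q ^ᴾ n) (q ^ᴾ (n C 2)) ⟩
    s *ᴾ (q ^ᴾ n *ᴾ (S *ᴾ q ^ᴾ (n C 2))) ∎
    where
    s = constant -1ℤ
    S = s ^ᴾ (n + 1)

  casoratian-1 : ∀ n → casoratian n 1 ≈ prefactor n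
  casoratian-1 zero    = coeffwise λ where
    zero    → ≡.refl
    (suc _) → ≡.refl
  casoratian-1 (suc n) = begin
    casoratian (suc n) 1                             ≈⟨ casoratian-1-step n ⟩
    constant -1ℤ *ᴾ (q ^ᴾ n *ᴾ casoratian n 1)
      ≈⟨ *ᴾ-congˡ (constant -1ℤ) (*ᴾ-congˡ (q ^ᴾ n) (casoratian-1 n)) ⟩
    constant -1ℤ *ᴾ (q ^ᴾ n *ᴾ prefactor n)          ≈⟨ prefactor-step n ⟨
    prefactor (suc n)                                ∎

  -- The recurrence for a single term of the sum.

  -- Raising `k` by one raises exactly one of the two exponents, that of the multiplier at `n + k`.
  Increment : ℕ → ℕ → Set
  Increment n k =
      (multiplier a b (n + k) ≡ constant (+ a)
        × exponent (n + 1) (suc k) ≡ suc (exponent (n + 1) k)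
        × exponent n (suc k) ≡ exponent n k)
    ⊎ (multiplier a b (n + k) ≡ constant (+ b)
        × exponent (n + 1) (suc k) ≡ exponent (n + 1) k
        × exponent n (suc k) ≡ suc (exponent n k))

  -- Both parities are checked for `n` and for `k`. Adding 2 to `n` changes nothing; adding 2 to `k`
  -- keeps the multiplier and raises all the exponents by one.
  increment : ∀ n k → Increment n k
  increment 0 0 = inj₁ (≡.refl , ≡.refl , ≡.refl)
  increment 1 0 = inj₂ (≡.refl , ≡.refl , ≡.refl)
  increment 0 1 = inj₂ (≡.refl , ≡.refl , ≡.refl)
  increment 1 1 = inj₁ (≡.refl , ≡.refl , ≡.refl)
  increment n (suc (suc k))
    rewrite ℕ.+-suc n (suc k) | ℕ.+-suc n k
          | exponent-2+ʳ n k | exponent-2+ʳ n (suc k)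
          | exponent-2+ʳ (n + 1) k | exponent-2+ʳ (n + 1) (suc k)
    with increment n k
  ... | inj₁ (e , f , g) = inj₁ (e , cong suc f , cong suc g)
  ... | inj₂ (e , f , g) = inj₂ (e , cong suc f , cong suc g)
  increment (suc (suc n)) k
    rewrite exponent-2+ˡ n k | exponent-2+ˡ n (suc k)
          | exponent-2+ˡ (n + 1) k | exponent-2+ˡ (n + 1) (suc k)
    = increment n k

  -- The coefficient is a parameter, so that Pascal's rule can split it over a fixed monomial and
  -- the coefficient for `k` can meet the monomial for `suc k`.
  term : Poly → ℕ → ℕ → ℕ → Poly
  term c n k j =
    c *ᴾ constant (+ a) ^ᴾ (exponent (n + 1) k ∸ j)
      *ᴾ constant (+ b) ^ᴾ (exponent n k ∸ j)
      *ᴾ q ^ᴾ (j * j + n * j)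

  summand : ℕ → ℕ → ℕ → Poly
  summand n k j = term ((k ∸ j) choose j) n k j

  total : ℕ → ℕ → Poly
  total n k = ∑[ i < suc k ] summand n k (toℕ i)

  summand-vanishes : ∀ n k j → ⌊ k /2⌋ < j → summand n k j ≡ 0ᴾ
  summand-vanishes n k j h =
    cong (λ c → term c n k j) (n<k⇒nchoosek≡0 (⌊k/2⌋<j⇒k∸j<j h))

  -- Since `j` is at most both exponents, the subtraction does not truncate, and the increment
  -- becomes one more factor a or b.
  term-suc : ∀ c n k j → j ≤ ⌊ k /2⌋ → term c n (suc k) j ≈ multiplier a b (n + k) *ᴾ term c n k j
  term-suc c n k j j≤⌊k/2⌋ with increment n k
  ... | inj₁ (e , f , g)
    rewrite e | f | g | ℕ.+-∸-assoc 1 (ℕ.≤-trans j≤⌊k/2⌋ (⌊k/2⌋≤exponent (n + 1) k)) =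
    solve 5 (λ c m x y z → c :* (m :* x) :* y :* z := m :* (c :* x :* y :* z)) ≈-refl
      c (constant (+ a)) (constant (+ a) ^ᴾ (exponent (n + 1) k ∸ j))
      (constant (+ b) ^ᴾ (exponent n k ∸ j)) (q ^ᴾ (j * j + n * j))
  ... | inj₂ (e , f , g)
    rewrite e | f | g | ℕ.+-∸-assoc 1 (ℕ.≤-trans j≤⌊k/2⌋ (⌊k/2⌋≤exponent n k)) =
    solve 5 (λ c m x y z → c :* x :* (m :* y) :* z := m :* (c :* x :* y :* z)) ≈-refl
      c (constant (+ b)) (constant (+ a) ^ᴾ (exponent (n + 1) k ∸ j))
      (constant (+ b) ^ᴾ (exponent n k ∸ j)) (q ^ᴾ (j * j + n * j))

  -- Beyond `⌊ k /2⌋` the exponents may truncate, but there the coefficient is zero.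
  term-choose-suc : ∀ n k j →
    term ((k ∸ j) choose j) n (suc k) j ≈ multiplier a b (n + k) *ᴾ summand n k j
  term-choose-suc n k j with j ≤? ⌊ k /2⌋
  ... | yes j≤⌊k/2⌋ = term-suc ((k ∸ j) choose j) n k j j≤⌊k/2⌋
  ... | no  j≰⌊k/2⌋
    rewrite n<k⇒nchoosek≡0 (⌊k/2⌋<j⇒k∸j<j (ℕ.≰⇒> j≰⌊k/2⌋)) =
    ≈-sym (*ᴾ-zeroʳ (multiplier a b (n + k)))

  term-cong : ∀ {c d} n k j → c ≈ d → term c n k j ≈ term d n k j
  term-cong n k j c≈d = *ᴾ-congʳ (*ᴾ-congʳ (*ᴾ-congʳ c≈d))

  summand-0 : ∀ n k → summand n (suc k) 0 ≈ multiplier a b (n + k) *ᴾ summand n k 0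
  summand-0 n k = begin
    summand n (suc k) 0
      ≈⟨ term-cong n (suc k) 0 (≈-trans (nchoose0≈1 (suc k)) (≈-sym (nchoose0≈1 k))) ⟩
    term (k choose 0) n (suc k) 0
      ≈⟨ term-choose-suc n k 0 ⟩
    multiplier a b (n + k) *ᴾ summand n k 0 ∎

  -- Both exponents grow by one together with `j`, so the powers of a and b do not change. The
  -- q-power `r` from Pascal's rule makes up the difference of the quadratic exponents.
  term-2+ : ∀ c n k j r → j + (j + r) ≡ k →
    term (q ^ᴾ r *ᴾ c) n (suc (suc k)) (suc j) ≈ q ^ᴾ (n + suc k) *ᴾ term c n k j
  term-2+ c n k j r j+[j+r]≡k = begin
    term (q ^ᴾ r *ᴾ c) n (suc (suc k)) (suc j)
      ≡⟨ cong₂ (λ x y → q ^ᴾ r *ᴾ c *ᴾ constant (+ a) ^ᴾ (x ∸ suc j) *ᴾ constant (+ b) ^ᴾ (y ∸ suc j)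
                          *ᴾ q ^ᴾ (suc j * suc j + n * suc j))
           (exponent-2+ʳ (n + 1) k) (exponent-2+ʳ n k) ⟩
    q ^ᴾ r *ᴾ c *ᴾ A *ᴾ B *ᴾ q ^ᴾ (suc j * suc j + n * suc j)
      ≈⟨ solve 5 (λ x c A B y → x :* c :* A :* B :* y := x :* y :* (c :* A :* B)) ≈-refl
           (q ^ᴾ r) c A B (q ^ᴾ (suc j * suc j + n * suc j)) ⟩
    q ^ᴾ r *ᴾ q ^ᴾ (suc j * suc j + n * suc j) *ᴾ (c *ᴾ A *ᴾ B)
      ≈⟨ *ᴾ-congʳ (^ᴾ-homo-* q r (suc j * suc j + n * suc j)) ⟨
    q ^ᴾ (r + (suc j * suc j + n * suc j)) *ᴾ (c *ᴾ A *ᴾ B)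
      ≡⟨ cong (λ e → q ^ᴾ e *ᴾ (c *ᴾ A *ᴾ B)) exponents ⟩
    q ^ᴾ ((n + suc k) + (j * j + n * j)) *ᴾ (c *ᴾ A *ᴾ B)
      ≈⟨ *ᴾ-congʳ (^ᴾ-homo-* q (n + suc k) (j * j + n * j)) ⟩
    q ^ᴾ (n + suc k) *ᴾ q ^ᴾ (j * j + n * j) *ᴾ (c *ᴾ A *ᴾ B)
      ≈⟨ solve 5 (λ x c A B y → x :* y :* (c :* A :* B) := x :* (c :* A :* B :* y)) ≈-refl
           (q ^ᴾ (n + suc k)) c A B (q ^ᴾ (j * j + n * j)) ⟩
    q ^ᴾ (n + suc k) *ᴾ (c *ᴾ A *ᴾ B *ᴾ q ^ᴾ (j * j + n * j)) ∎
    where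
    A = constant (+ a) ^ᴾ (exponent (n + 1) k ∸ j)
    B = constant (+ b) ^ᴾ (exponent n k ∸ j)

    exponents : r + (suc j * suc j + n * suc j) ≡ (n + suc k) + (j * j + n * j)
    exponents rewrite ≡.sym j+[j+r]≡k = N.solve 3
      (λ n j r → r N.:+ ((N.con 1 N.:+ j) N.:* (N.con 1 N.:+ j) N.:+ n N.:* (N.con 1 N.:+ j))
        N.:= (n N.:+ (N.con 1 N.:+ (j N.:+ (j N.:+ r)))) N.:+ (j N.:* j N.:+ n N.:* j))
      ≡.refl n j r
      where module N = ℕSolver.+-*-Solver

  term-+ : ∀ c d n k j → term (c +ᴾ d) n k j ≈ term c n k j +ᴾ term d n k j
  term-+ c d n k j =
    solve 5 (λ c d x y z → (c :+ d) :* x :* y :* z := c :* x :* y :* z :+ d :* x :* y :* z) ≈-refl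
      c d (constant (+ a) ^ᴾ (exponent (n + 1) k ∸ j))
      (constant (+ b) ^ᴾ (exponent n k ∸ j)) (q ^ᴾ (j * j + n * j))

  summand-suc : ∀ n k j → summand n (suc (suc k)) (suc j) ≈
    multiplier a b (n + suc k) *ᴾ summand n (suc k) (suc j) +ᴾ q ^ᴾ (n + suc k) *ᴾ summand n k j
  summand-suc n k j with j ≤? ⌊ k /2⌋
  -- Past the middle all three summands vanish.
  ... | no j≰⌊k/2⌋
    rewrite summand-vanishes n (suc (suc k)) (suc j) (s≤s (ℕ.≰⇒> j≰⌊k/2⌋))
          | summand-vanishes n (suc k) (suc j)
              (s≤s (ℕ.≤-trans (ℕ.⌊n/2⌋-mono (ℕ.n≤1+n (suc k))) (ℕ.≰⇒> j≰⌊k/2⌋)))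
          | summand-vanishes n k j (ℕ.≰⇒> j≰⌊k/2⌋) =
    ≈-sym (+ᴾ-cong (*ᴾ-zeroʳ (multiplier a b (n + suc k))) (*ᴾ-zeroʳ (q ^ᴾ (n + suc k))))
  ... | yes j≤⌊k/2⌋ = begin
    term ((suc k ∸ j) choose suc j) n (suc (suc k)) (suc j)
      ≈⟨ term-cong n (suc (suc k)) (suc j) pascal ⟩
    term (c +ᴾ q ^ᴾ r *ᴾ d) n (suc (suc k)) (suc j)
      ≈⟨ term-+ c (q ^ᴾ r *ᴾ d) n (suc (suc k)) (suc j) ⟩
    term c n (suc (suc k)) (suc j) +ᴾ term (q ^ᴾ r *ᴾ d) n (suc (suc k)) (suc j)
      -- The index `suc k ∸ suc j` computes to `k ∸ j`, so `c` is the coefficient of the summand for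
      -- `suc k` and `suc j`.
      ≈⟨ +ᴾ-cong (term-choose-suc n (suc k) (suc j)) (term-2+ d n k j r j+[j+r]≡k) ⟩
    multiplier a b (n + suc k) *ᴾ summand n (suc k) (suc j) +ᴾ q ^ᴾ (n + suc k) *ᴾ summand n k j ∎
    where
    c = (k ∸ j) choose suc j
    d = (k ∸ j) choose j
    r = k ∸ (j + j)

    j+[j+r]≡k : j + (j + r) ≡ k
    j+[j+r]≡k = ≡.trans (≡.sym (ℕ.+-assoc j j r)) (ℕ.m+[n∸m]≡n (j≤⌊k/2⌋⇒j+j≤k j≤⌊k/2⌋))

    j≤k : j ≤ k
    j≤k = ℕ.≤-trans j≤⌊k/2⌋ (ℕ.⌊n/2⌋≤n k)

    j+r≡k∸j : j + r ≡ k ∸ j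
    j+r≡k∸j = ≡.trans (≡.sym (ℕ.m+n∸m≡n j (j + r))) (cong (_∸ j) j+[j+r]≡k)

    pascal : (suc k ∸ j) choose suc j ≈ c +ᴾ q ^ᴾ r *ᴾ d
    pascal = begin
      (suc k ∸ j) choose suc j
        ≡⟨ cong (_choose suc j) (ℕ.+-∸-assoc 1 j≤k) ⟩
      suc (k ∸ j) choose suc j
        ≡⟨ cong (λ l → suc l choose suc j) j+r≡k∸j ⟨
      suc (j + r) choose suc j
        ≈⟨ choose-pascal j r ⟩
      (j + r) choose suc j +ᴾ q ^ᴾ r *ᴾ (j + r) choose j
        ≡⟨ cong (λ l → l choose suc j +ᴾ q ^ᴾ r *ᴾ l choose j) j+r≡k∸j ⟩
      c +ᴾ q ^ᴾ r *ᴾ d ∎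

  -- The recurrence for the whole sum.

  -- Totals for successive `k` have different lengths; padding by a vanishing summand lets them be
  -- added termwise.
  total-extend : ∀ n k → ∑[ i < suc (suc k) ] summand n k (toℕ i) ≈ total n k
  total-extend n k = begin
    ∑[ i < suc (suc k) ] summand n k (toℕ i)   ≈⟨ ∑-last (suc k) (summand n k) ⟩
    total n k +ᴾ summand n k (suc k)           ≡⟨ cong (total n k +ᴾ_) (summand-vanishes n k (suc k) (s≤s (ℕ.⌊n/2⌋≤n k))) ⟩
    total n k +ᴾ 0ᴾ                            ≈⟨ +ᴾ-identityʳ (total n k) ⟩
    total n k                                  ∎

  total-0 : ∀ n → total n 0 ≈ 1ᴾ
  total-0 n = begin
    (0 choose 0) *ᴾ 1ᴾ *ᴾ 1ᴾ *ᴾ q ^ᴾ (n * 0) +ᴾ 0ᴾ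
      ≡⟨ cong (λ e → (0 choose 0) *ᴾ 1ᴾ *ᴾ 1ᴾ *ᴾ q ^ᴾ e +ᴾ 0ᴾ) (ℕ.*-zeroʳ n) ⟩
    (0 choose 0) *ᴾ 1ᴾ *ᴾ 1ᴾ *ᴾ 1ᴾ +ᴾ 0ᴾ
      ≈⟨ solve 1 (λ c → c :* con 1 :* con 1 :* con 1 :+ con 0 := c) ≈-refl (0 choose 0) ⟩
    0 choose 0
      ≈⟨ nchoose0≈1 0 ⟩
    1ᴾ ∎

  total-1 : ∀ n → total n 1 ≈ multiplier a b (n + 0) *ᴾ total n 0
  total-1 n = begin
    summand n 1 0 +ᴾ (summand n 1 1 +ᴾ 0ᴾ)
      ≡⟨ cong (λ x → summand n 1 0 +ᴾ (x +ᴾ 0ᴾ)) (summand-vanishes n 1 1 (s≤s z≤n)) ⟩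
    summand n 1 0 +ᴾ 0ᴾ
      ≈⟨ +ᴾ-identityʳ (summand n 1 0) ⟩
    summand n 1 0
      ≈⟨ summand-0 n 0 ⟩
    multiplier a b (n + 0) *ᴾ summand n 0 0
      ≈⟨ *ᴾ-congˡ (multiplier a b (n + 0)) (+ᴾ-identityʳ (summand n 0 0)) ⟨
    multiplier a b (n + 0) *ᴾ total n 0 ∎

  total-step : ∀ n k → total n (suc (suc k)) ≈
    multiplier a b (n + suc k) *ᴾ total n (suc k) +ᴾ q ^ᴾ (n + suc k) *ᴾ total n k
  total-step n k = begin
    summand n (suc (suc k)) 0 +ᴾ ∑[ i < suc (suc k) ] summand n (suc (suc k)) (suc (toℕ i))
      -- The summand at 0 has no predecessor in Pascal's rule and is treated apart.
      ≈⟨ +ᴾ-cong (summand-0 n (suc k)) (SumProperties.sum-cong-≋ +-commutativeMonoid {suc (suc k)} (λ i → summand-suc n k (toℕ i))) ⟩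
    m *ᴾ x +ᴾ ∑[ i < suc (suc k) ] (m *ᴾ summand n (suc k) (suc (toℕ i)) +ᴾ Q *ᴾ summand n k (toℕ i))
      ≈⟨ +ᴾ-congˡ {m *ᴾ x} (∑-linear (suc (suc k)) m Q (summand n (suc k) ∘ suc) (summand n k)) ⟩
    m *ᴾ x +ᴾ (m *ᴾ X +ᴾ Q *ᴾ Y)
      ≈⟨ solve 5 (λ m x X Q Y → m :* x :+ (m :* X :+ Q :* Y) := m :* (x :+ X) :+ Q :* Y) ≈-refl
           m x X Q Y ⟩
    m *ᴾ (x +ᴾ X) +ᴾ Q *ᴾ Y
      ≈⟨ +ᴾ-cong (*ᴾ-congˡ m (total-extend n (suc k))) (*ᴾ-congˡ Q (total-extend n k)) ⟩
    m *ᴾ total n (suc k) +ᴾ Q *ᴾ total n k ∎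
    where
    m = multiplier a b (n + suc k)
    Q = q ^ᴾ (n + suc k)
    x = summand n (suc k) 0
    X = ∑[ i < suc (suc k) ] summand n (suc k) (suc (toℕ i))
    Y = ∑[ i < suc (suc k) ] summand n k (toℕ i)

  -- Comparison of the two recurrences.

  casoratian≈prefactor*total : ∀ n k → casoratian n (suc k) ≈ prefactor n *ᴾ total n k
  casoratian≈prefactor*total n 0 = begin
    casoratian n 1                ≈⟨ casoratian-1 n ⟩
    prefactor n                   ≈⟨ *ᴾ-identityʳ (prefactor n) ⟨
    prefactor n *ᴾ 1ᴾ             ≈⟨ *ᴾ-congˡ (prefactor n) (total-0 n) ⟨
    prefactor n *ᴾ total n 0      ∎
  -- This second base case uses `casoratian n 0`, which is zero and corresponds to no `total`.
  casoratian≈prefactor*total n 1 = begin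
    casoratian n 2
      ≈⟨ casoratian-step n 0 ⟩
    m *ᴾ casoratian n 1 +ᴾ Q *ᴾ casoratian n 0
      ≈⟨ +ᴾ-cong (*ᴾ-congˡ m (casoratian≈prefactor*total n 0)) (*ᴾ-congˡ Q (casoratian-0 n)) ⟩
    m *ᴾ (prefactor n *ᴾ total n 0) +ᴾ Q *ᴾ 0ᴾ
      ≈⟨ solve 4 (λ m Q c x → m :* (c :* x) :+ Q :* con 0 := c :* (m :* x)) ≈-refl
           m Q (prefactor n) (total n 0) ⟩
    prefactor n *ᴾ (m *ᴾ total n 0)
      ≈⟨ *ᴾ-congˡ (prefactor n) (total-1 n) ⟨
    prefactor n *ᴾ total n 1 ∎
    where
    m = multiplier a b (n + 0)
    Q = q ^ᴾ (n + 0)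
  casoratian≈prefactor*total n (suc (suc k)) = begin
    casoratian n (suc (suc (suc k)))
      ≈⟨ casoratian-step n (suc k) ⟩
    m *ᴾ casoratian n (suc (suc k)) +ᴾ Q *ᴾ casoratian n (suc k)
      ≈⟨ +ᴾ-cong (*ᴾ-congˡ m (casoratian≈prefactor*total n (suc k)))
                 (*ᴾ-congˡ Q (casoratian≈prefactor*total n k)) ⟩
    m *ᴾ (prefactor n *ᴾ total n (suc k)) +ᴾ Q *ᴾ (prefactor n *ᴾ total n k)
      ≈⟨ solve 5 (λ m Q c x y → m :* (c :* x) :+ Q :* (c :* y) := c :* (m :* x :+ Q :* y)) ≈-refl
           m Q (prefactor n) (total n (suc k)) (total n k) ⟩
    prefactor n *ᴾ (m *ᴾ total n (suc k) +ᴾ Q *ᴾ total n k)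
      ≈⟨ *ᴾ-congˡ (prefactor n) (total-step n k) ⟨
    prefactor n *ᴾ total n (suc (suc k)) ∎
    where
    m = multiplier a b (n + suc k)
    Q = q ^ᴾ (n + suc k)

theorem4 : (a b : ℕ) .{{_ : NonZero a}} .{{_ : NonZero b}} (n k : ℕ) → 1 ≤ k →
    F a b n *ᴾ F̂ a b (n + k) -ᴾ F a b (n + k) *ᴾ F̂ a b n
    ≈ constant -1ℤ ^ᴾ (n + 1) *ᴾ q ^ᴾ (n C 2) *ᴾ
    ∑[ i < k ]
    (let j = toℕ i in
    (k ∸ 1 ∸ j) choose j
    *ᴾ constant (+ a) ^ᴾ (⌊ k ∸ 1 /2⌋ + ξ (k + 1) * ξ (n + 1) ∸ j)
    *ᴾ constant (+ b) ^ᴾ (⌊ k ∸ 1 /2⌋ + ξ (k + 1) * ξ n ∸ j)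
    *ᴾ q ^ᴾ (j * j + n * j))
theorem4 a b n k@(suc k-1) _ = begin
  F a b n *ᴾ F̂ a b (n + k) -ᴾ F a b (n + k) *ᴾ F̂ a b n
    -- Only the subtraction has to be rewritten; otherwise both sides agree with `casoratian`,
    -- `prefactor` and `total` by unfolding.
    ≈⟨ +ᴾ-congˡ {F a b n *ᴾ F̂ a b (n + k)} (RingProperties.-1*x≈-x ring (F a b (n + k) *ᴾ F̂ a b n)) ⟨
  casoratian a b n k
    ≈⟨ casoratian≈prefactor*total a b n k-1 ⟩
  prefactor a b n *ᴾ total a b n k-1 ∎
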